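{- For every positive integer $n$, $\text{sat}^*(n,\mathcal D_2)=n+1$. That is, every diamond-saturated family $\mathcal F\subseteq\mathcal P([n])$ has $|\mathcal F|\geq n+1$, and there exists a diamond-saturated family $\mathcal F\subseteq\mathcal P([n])$ with $|\mathcal F|=n+1$.
   Context: $[n]=\{1,\dots,n\}$ and $\mathcal P([n])$ is its power set, ordered by inclusion. The diamond $\mathcal D_2$ is the 4-element poset with a minimum, a maximum and two incomparable middle elements. A family $\mathcal F\subseteq\mathcal P([n])$ contains an induced diamond if there are four distinct sets $D,P,Q,T\in\mathcal F$ with $D\subsetneq P\subsetneq T$, $D\subsetneq Q\subsetneq T$, and $P,Q$ incomparable. $\mathcal F$ is diamond-saturated if it contains no induced diamond but for every $S\in\mathcal P([n])\setminus\mathcal F$ the family $\mathcal F\cup\{S\}$ contains an induced diamond. $\text{sat}^*(n,\mathcal D_2)$ is the minimum size of a diamond-saturated family in $\mathcal P([n])$. -}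

module Defs where

open import Data.Nat using (ℕ)
open import Data.List using (List; length)
open import Data.List.Membership.Propositional using (_∈_; _∉_)
open import Data.List.Relation.Unary.Unique.Propositional using (Unique)
open import Data.Product using (∃-syntax; _×_)
open import Data.Sum using (_⊎_)
open import Relation.Nullary using (¬_)
open import Relation.Binary.PropositionalEquality using (_≡_)
open import Data.Fin.Subset using (Subset; _⊆_; _⊂_)

record Family (n : ℕ) : Set where
  constructor family
  field
    sets   : List (Subset n)
    unique : Unique sets
open Family public

size : ∀ {n} → Family n → ℕ
size F = length (sets F)

Incomparable : ∀ {n} → Subset n → Subset n → Set
Incomparable P Q = ¬ (P ⊆ Q) × ¬ (Q ⊆ P)

-- An induced diamond D ⊂ P ⊂ T, D ⊂ Q ⊂ T, P,Q incomparable, all in the list L.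
-- (Distinctness of D,P,Q,T follows from strict inclusions and incomparability.)
InducedDiamondIn : ∀ {n} → List (Subset n) → Set
InducedDiamondIn {n} L =
  ∃[ D ] ∃[ P ] ∃[ Q ] ∃[ T ]
    (D ∈ L × P ∈ L × Q ∈ L × T ∈ L ×
     D ⊂ P × P ⊂ T × D ⊂ Q × Q ⊂ T × Incomparable P Q)

DiamondSaturated : ∀ {n} → Family n → Set
DiamondSaturated {n} F =
  ¬ InducedDiamondIn (sets F) ×
  (∀ (S : Subset n) → S ∉ sets F → InducedDiamondIn (S Data.List.∷ sets F))

{-# OPTIONS --safe #-}
module Submission where

-- Suppose F is diamond-saturated with at most n members. Then some nonzero
-- integer vector w makes w(X) the same for all X ∈ F; write p and q for the
-- positive and negative parts of w. Every S with another weight lies outside F,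
-- hence is the bottom, a middle element or the top of a new diamond.
--
-- Applying this to S = T ∩ {q = 0}, with T ∈ F maximising q(T) + |T ∩ {q = 0}|,
-- yields D ∈ F with q(D) = 0; by symmetry some D′ ∈ F has p(D′) = 0, which forces the common
-- weight to be 0 and makes D disjoint from the support of w ("ground").
--
-- Applying it to S = (X ∩ {q = 0}) ∪ {p > 0} shows that X ∈ F contains a ground
-- member iff it lies below a member of F containing {p > 0}. Now fix y with
-- p(y) > 0 and let B be maximal among the members of F that avoid y and contain
-- a ground member. The set B ∪ {y} must be a middle element of a new diamond
-- D* ⊂ B ∪ {y}, Q ⊂ T*. But D* contains a ground member, which lies in B as well,
-- so B and Q are comparable, and then Q contradicts the maximality of B.

open import Defs
open import Data.Bool using (true; false; if_then_else_)
open import Data.Empty using (⊥-elim)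
open import Data.Fin using (Fin; zero; suc)
open import Data.Fin.Properties using (¬∀⟶∃¬)
open import Data.Fin.Subset
  using (Subset; inside; outside; ⊥; ⊤; ⁅_⁆; _∩_; _∪_; _⊆_; _⊂_; ∣_∣)
  renaming (_∈_ to _∈ₛ_; _∉_ to _∉ₛ_)
open import Data.Fin.Subset.Properties
  using (_∈?_; _⊆?_; ⊆-refl; ⊆-trans; ⊆-antisym; ⊆-min; ⊆-max; ⊂-irref; ∈⊤; ∉⊥; x∈⁅x⁆; x∈⁅y⁆⇒x≡y;
         p∩q⊆p; p∩q⊆q; x∈p∩q⁺; p⊆p∪q; q⊆p∪q; x∈p∪q⁻; p⊂q⇒∣p∣<∣q∣; ∣p∣≤n; drop-there; s⊆s; drop-∷-⊆)
open import Data.Integer as ℤ using (ℤ; +_; -[1+_]; 0ℤ; 1ℤ)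
import Data.Integer.Properties as ℤ
open import Data.Integer.Tactic.RingSolver using (solve-∀)
open import Data.List using (List; []; _∷_; _++_; map; length)
open import Data.List.Membership.Propositional using (_∈_; _∉_; find; lose)
open import Data.List.Membership.Propositional.Properties
  using (∈-∃++; ∈-++⁻; ∈-++⁺ˡ; ∈-++⁺ʳ; ∈-map⁺; ∈-map⁻)
open import Data.List.Properties using (length-++; length-map)
import Data.List.Relation.Unary.All as All
import Data.List.Relation.Unary.All.Properties as All
open import Data.List.Relation.Unary.AllPairs using ([]; _∷_)
open import Data.List.Relation.Unary.Any using (here; there; any?)
open import Data.List.Relation.Unary.Unique.Propositional using (Unique)
import Data.List.Relation.Unary.Unique.Propositional.Properties as Unique
open import Data.Nat using (ℕ; zero; suc; _+_; _≤_; _<_; _≥_; z≤n; s≤s; _<?_)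
open import Data.Nat.Properties
open import Data.Product using (Σ; _×_; _,_; ∃-syntax; proj₁; proj₂)
open import Data.Sum using (_⊎_; inj₁; inj₂; swap)
open import Data.Vec as Vec using (Vec; []; _∷_; head; here; lookup; replicate; tabulate; there; zipWith)
open import Data.Vec.Properties using ([]=⇒lookup; lookup⇒[]=; lookup∘tabulate; lookup-map; ∷-injectiveʳ)
open import Level using (0ℓ)
open import Relation.Binary.PropositionalEquality
  using (_≡_; _≢_; refl; sym; trans; cong; cong₂; subst; module ≡-Reasoning)
open import Relation.Nullary using (¬_; yes; no; does; contradiction)
open import Relation.Nullary.Decidable using (_→-dec_; ¬?; decidable-stable)
open import Relation.Unary using (Pred; Decidable)

-- Bounded ascent and decidable subsets.

-- Replaces the choice of an element maximising h.
ascend : {A R : Set} (h : A → ℕ) (b : ℕ) → (∀ a → h a ≤ b) →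
         (∀ a → R ⊎ (∃[ a′ ] h a < h a′)) → A → R
ascend {A} {R} h b bounded step a₀ = go (suc b) a₀ (m≤n+m (suc b) (h a₀))
  where
  -- The fuel `k` exceeds what `h` can still gain; at `k = 0` this contradicts `bounded`.
  go : ∀ k a → b < h a + k → R
  go zero a b<h = contradiction (<-≤-trans b<h (≤-trans (≤-reflexive (+-identityʳ _)) (bounded a))) (<-irrefl refl)
  go (suc k) a b<h with step a
  ... | inj₁ r         = r
  ... | inj₂ (a′ , lt) = go k a′ (<-≤-trans b<h (≤-trans (≤-reflexive (+-suc (h a) k)) (+-monoˡ-≤ k lt)))

⊆∧⊈⇒⊂ : ∀ {n} {p q : Subset n} → p ⊆ q → ¬ (q ⊆ p) → p ⊂ q
⊆∧⊈⇒⊂ {n} {p} {q} p⊆q q⊈p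
  with ¬∀⟶∃¬ n (λ x → x ∈ₛ q → x ∈ₛ p) (λ x → (x ∈? q) →-dec (x ∈? p)) (λ f → q⊈p (λ {x} → f x))
... | x , ¬imp with x ∈? q
...   | yes x∈q = p⊆q , x , x∈q , λ x∈p → ¬imp (λ _ → x∈p)
...   | no  x∉q = contradiction (λ x∈q → contradiction x∈q x∉q) ¬imp

separate : ∀ {n} {P : Pred (Fin n) 0ℓ} → Decidable P → Subset n
separate P? = tabulate (λ x → does (P? x))

∈-separate⁺ : ∀ {n} {P : Pred (Fin n) 0ℓ} (P? : Decidable P) {x} → P x → x ∈ₛ separate P?
∈-separate⁺ P? {x} px = lookup⇒[]= x _ (trans (lookup∘tabulate _ x) eq)
  where
  eq : does (P? x) ≡ true
  eq with P? x
  ... | yes _  = refl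
  ... | no ¬px = contradiction px ¬px

∈-separate⁻ : ∀ {n} {P : Pred (Fin n) 0ℓ} (P? : Decidable P) {x} → x ∈ₛ separate P? → P x
∈-separate⁻ P? {x} x∈ with P? x | trans (sym (lookup∘tabulate (λ x → does (P? x)) x)) ([]=⇒lookup x∈)
... | yes px | _ = px
... | no _   | ()

-- Weights of subsets.

weight : ∀ {n} → (Fin n → ℕ) → Subset n → ℕ
weight f []          = 0
weight f (true ∷ X)  = f zero + weight (λ x → f (suc x)) X
weight f (false ∷ X) = weight (λ x → f (suc x)) X

vanishes-at-zero : ∀ {n} (f : Fin (suc n) → ℕ) {X Y : Subset n} →
                   (∀ {x} → x ∈ₛ inside ∷ X → 0 < f x → x ∈ₛ outside ∷ Y) → f zero ≡ 0
vanishes-at-zero f h = n≤0⇒n≡0 (≮⇒≥ λ lt → contradiction (h here lt) λ ())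

-- Points where `f` vanishes contribute nothing, so `X` may stick out of `Y` there. This slack
-- allows comparison with a set cut down to the support of `f`.
weight-mono : ∀ {n} (f : Fin n → ℕ) (X Y : Subset n) →
              (∀ {x} → x ∈ₛ X → 0 < f x → x ∈ₛ Y) → weight f X ≤ weight f Y
weight-mono f [] [] h = z≤n
weight-mono f (b ∷ X) (c ∷ Y) h = by-head b c h
  where
  tails : weight (λ x → f (suc x)) X ≤ weight (λ x → f (suc x)) Y
  tails = weight-mono _ X Y (λ x∈X lt → drop-there (h (there x∈X) lt))
  by-head : ∀ b c → (∀ {x} → x ∈ₛ b ∷ X → 0 < f x → x ∈ₛ c ∷ Y) → weight f (b ∷ X) ≤ weight f (c ∷ Y)
  by-head true  true  _ = +-monoʳ-≤ (f zero) tails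
  by-head false true  _ = m≤n⇒m≤o+n (f zero) tails
  by-head false false _ = tails
  by-head true  false h rewrite vanishes-at-zero f h = tails

weight-mono-< : ∀ {n} (f : Fin n → ℕ) (X Y : Subset n) →
                (∀ {x} → x ∈ₛ X → 0 < f x → x ∈ₛ Y) →
                ∀ {y} → y ∈ₛ Y → y ∉ₛ X → 0 < f y → weight f X < weight f Y
weight-mono-< f (true ∷ X) (true ∷ Y) h {zero} y∈Y y∉X lt = contradiction here y∉X
weight-mono-< f (false ∷ X) (true ∷ Y) h {zero} y∈Y y∉X lt =
  +-mono-<-≤ lt (weight-mono _ X Y (λ x∈X l → drop-there (h (there x∈X) l)))
weight-mono-< f (b ∷ X) (c ∷ Y) h {suc y} (there y∈Y) y∉X lt = by-head b c h
  where
  tails : weight (λ x → f (suc x)) X < weight (λ x → f (suc x)) Y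
  tails = weight-mono-< _ X Y (λ x∈X l → drop-there (h (there x∈X) l)) y∈Y (λ y∈X → y∉X (there y∈X)) lt
  by-head : ∀ b c → (∀ {x} → x ∈ₛ b ∷ X → 0 < f x → x ∈ₛ c ∷ Y) → weight f (b ∷ X) < weight f (c ∷ Y)
  by-head true  true  _ = +-monoʳ-< (f zero) tails
  by-head false true  _ = m≤n⇒m≤o+n (f zero) tails
  by-head false false _ = tails
  by-head true  false h rewrite vanishes-at-zero f h = tails

weight-⊥ : ∀ {n} (f : Fin n → ℕ) → weight f ⊥ ≡ 0
weight-⊥ {zero}  f = refl
weight-⊥ {suc n} f = weight-⊥ (λ x → f (suc x))

weight≡0⁺ : ∀ {n} (f : Fin n → ℕ) (X : Subset n) → (∀ {x} → x ∈ₛ X → f x ≡ 0) → weight f X ≡ 0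
weight≡0⁺ f X h = n≤0⇒n≡0 (subst (weight f X ≤_) (weight-⊥ f)
  (weight-mono f X ⊥ (λ x∈X lt → contradiction (h x∈X) (>⇒≢ lt))))

weight≡0⁻ : ∀ {n} (f : Fin n → ℕ) (X : Subset n) → weight f X ≡ 0 → ∀ {x} → x ∈ₛ X → f x ≡ 0
weight≡0⁻ f X eq {x} x∈X with f x in fx
... | zero  = refl
... | suc k = contradiction (subst (weight f ⊥ <_) eq
  (weight-mono-< f ⊥ X (λ x∈⊥ → contradiction x∈⊥ ∉⊥) x∈X ∉⊥ (subst (0 <_) (sym fx) (s≤s z≤n)))) λ ()

-- Models an integer vector by its positive and negative parts. Natural-valued parts keep weights
-- monotone, and exchanging signs is a swap of arguments.
SignsDisjoint : ∀ {n} (p q : Fin n → ℕ) → Set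
SignsDisjoint p q = ∀ x → p x ≡ 0 ⊎ q x ≡ 0

vanishesʳ : ∀ {n} {p q : Fin n → ℕ} → SignsDisjoint p q → ∀ {x} → 0 < p x → q x ≡ 0
vanishesʳ disjoint {x} lt with disjoint x
... | inj₁ px = contradiction px (>⇒≢ lt)
... | inj₂ qx = qx

positive? : ∀ {n} (f : Fin n → ℕ) → Decidable (λ x → 0 < f x)
positive? f x = 0 <? f x

zero? : ∀ {n} (f : Fin n → ℕ) → Decidable (λ x → f x ≡ 0)
zero? f x = f x ≟ 0

supp zeros : ∀ {n} → (Fin n → ℕ) → Subset n
supp f  = separate (positive? f)
zeros f = separate (zero? f)

isZero : ℕ → ℕ
isZero zero    = 1
isZero (suc _) = 0

isZero-positive : ∀ k → 0 < isZero k → k ≡ 0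
isZero-positive zero _ = refl

-- Roles of a new set in a saturated family.

module Saturated {n : ℕ} (L : List (Subset n)) (free : ¬ InducedDiamondIn L)
                 (saturated : ∀ S → S ∉ L → InducedDiamondIn (S ∷ L)) where

  -- Weak inclusions suffice because incomparability makes all four strict: `P ⊆ D`, for instance,
  -- would give `P ⊆ Q`.
  comparable : ∀ {D P Q T} → D ∈ L → P ∈ L → Q ∈ L → T ∈ L →
               D ⊆ P → P ⊆ T → D ⊆ Q → Q ⊆ T → P ⊆ Q ⊎ Q ⊆ P
  comparable {D} {P} {Q} {T} D∈ P∈ Q∈ T∈ DP PT DQ QT with P ⊆? Q | Q ⊆? P
  ... | yes PQ | _      = inj₁ PQ
  ... | no _   | yes QP = inj₂ QP
  ... | no ¬PQ | no ¬QP = ⊥-elim (free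
    (D , P , Q , T , D∈ , P∈ , Q∈ , T∈ ,
     ⊆∧⊈⇒⊂ DP (λ PD → ¬PQ (⊆-trans PD DQ)) , ⊆∧⊈⇒⊂ PT (λ TP → ¬QP (⊆-trans QT TP)) ,
     ⊆∧⊈⇒⊂ DQ (λ QD → ¬QP (⊆-trans QD DP)) , ⊆∧⊈⇒⊂ QT (λ TQ → ¬PQ (⊆-trans PT TQ)) ,
     ¬PQ , ¬QP))

  incomparable-impossible : ∀ {D P Q T} → D ∈ L → P ∈ L → Q ∈ L → T ∈ L →
                            D ⊆ P → P ⊆ T → D ⊆ Q → Q ⊆ T → ¬ Incomparable P Q
  incomparable-impossible D∈ P∈ Q∈ T∈ DP PT DQ QT (¬PQ , ¬QP)
    with comparable D∈ P∈ Q∈ T∈ DP PT DQ QT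
  ... | inj₁ PQ = ¬PQ PQ
  ... | inj₂ QP = ¬QP QP

  -- Strictness survives only in `P ⊂ T` of `bottom`, where it later makes a height increase. The
  -- two middle positions are symmetric and share a constructor.
  data Role (S : Subset n) : Set where
    bottom : ∀ {P Q T} → P ∈ L → Q ∈ L → T ∈ L → S ⊆ P → S ⊆ Q → P ⊂ T → Q ⊆ T →
             Incomparable P Q → Role S
    middle : ∀ {D Q T} → D ∈ L → Q ∈ L → T ∈ L → D ⊆ S → S ⊆ T → D ⊆ Q → Q ⊆ T →
             Incomparable S Q → Role S
    top    : ∀ {D P Q} → D ∈ L → P ∈ L → Q ∈ L → D ⊆ P → D ⊆ Q → P ⊆ S → Q ⊆ S →
             Incomparable P Q → Role S

  role : ∀ {S} → S ∉ L → Role S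
  role {S} S∉ with saturated S S∉
  ... | D , P , Q , T , there D∈ , there P∈ , there Q∈ , there T∈ , DP , PT , DQ , QT , i =
    ⊥-elim (free (D , P , Q , T , D∈ , P∈ , Q∈ , T∈ , DP , PT , DQ , QT , i))
  ... | _ , _ , _ , _ , here refl , there P∈ , there Q∈ , there T∈ , DP , PT , DQ , QT , i =
    bottom P∈ Q∈ T∈ (proj₁ DP) (proj₁ DQ) PT (proj₁ QT) i
  ... | _ , _ , _ , _ , there D∈ , here refl , there Q∈ , there T∈ , DP , PT , DQ , QT , i =
    middle D∈ Q∈ T∈ (proj₁ DP) (proj₁ PT) (proj₁ DQ) (proj₁ QT) i
  ... | _ , _ , _ , _ , there D∈ , there P∈ , here refl , there T∈ , DP , PT , DQ , QT , i =
    middle D∈ P∈ T∈ (proj₁ DQ) (proj₁ QT) (proj₁ DP) (proj₁ PT) (proj₂ i , proj₁ i)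
  ... | _ , _ , _ , _ , there D∈ , there P∈ , there Q∈ , here refl , DP , PT , DQ , QT , i =
    top D∈ P∈ Q∈ (proj₁ DP) (proj₁ DQ) (proj₁ PT) (proj₁ QT) i
  -- `S` cannot fill two positions, as the four sets of a diamond are distinct.
  ... | _ , _ , _ , _ , here refl , here refl , _ , _ , DP , PT , DQ , QT , i = contradiction DP (⊂-irref refl)
  ... | _ , _ , _ , _ , here refl , _ , here refl , _ , DP , PT , DQ , QT , i = contradiction DQ (⊂-irref refl)
  ... | _ , _ , _ , _ , here refl , _ , _ , here refl , DP , PT , DQ , QT , i = contradiction (⊆-antisym (proj₁ DP) (proj₁ PT)) λ { refl → ⊂-irref refl DP }
  ... | _ , _ , _ , _ , _ , here refl , here refl , _ , DP , PT , DQ , QT , i = ⊥-elim (proj₁ i ⊆-refl)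
  ... | _ , _ , _ , _ , _ , here refl , _ , here refl , DP , PT , DQ , QT , i = contradiction PT (⊂-irref refl)
  ... | _ , _ , _ , _ , _ , _ , here refl , here refl , DP , PT , DQ , QT , i = contradiction QT (⊂-irref refl)

  -- A member of zero `q`-weight.

  -- The hypothesis says that p - q is constant on `L`, without subtraction. Since `S = T ∩ zeros q`
  -- keeps all the `p`-weight of `T`, every member above `S` has at least the `p`-weight and hence
  -- at least the `q`-weight of `T`. So `S` as a bottom leads to a higher member, `S` as a middle
  -- has a `q`-free set below it, and `S` as a top could be replaced by `T`.
  weight-free-member : (p q : Fin n → ℕ) → SignsDisjoint p q →
    (∀ {X Y} → X ∈ L → Y ∈ L → weight p X + weight q Y ≡ weight p Y + weight q X) →
    ∀ {X} → X ∈ L → ∃[ D ] (D ∈ L × weight q D ≡ 0)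
  weight-free-member p q disjoint balanced {X} X∈ =
    ascend {A = ∃[ T ] T ∈ L} height (height′ ⊤) (λ (T , _) → height-mono {T} (λ _ → ∈⊤)) step (X , X∈)
    where
    z : Fin n → ℕ
    z x = isZero (q x)
    -- z makes the height strictly monotone; any T′ ∈ L above T ∩ {q = 0} is at least as high as T.
    height′ : Subset n → ℕ
    height′ T = weight q T + weight z T
    height : ∃[ T ] T ∈ L → ℕ
    height (T , _) = height′ T
    height-mono : ∀ {X Y} → X ⊆ Y → height′ X ≤ height′ Y
    height-mono {X} {Y} XY = +-mono-≤ (weight-mono q X Y (λ x∈ _ → XY x∈)) (weight-mono z X Y (λ x∈ _ → XY x∈))
    height-mono-< : ∀ {X Y} → X ⊂ Y → height′ X < height′ Y
    height-mono-< {X} {Y} (XY , x , x∈Y , x∉X) with q x in qx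
    ... | suc k = +-mono-<-≤ (weight-mono-< q X Y (λ x∈ _ → XY x∈) x∈Y x∉X (subst (0 <_) (sym qx) (s≤s z≤n)))
                             (weight-mono z X Y (λ x∈ _ → XY x∈))
    ... | zero  = +-mono-≤-< (weight-mono q X Y (λ x∈ _ → XY x∈))
                             (weight-mono-< z X Y (λ x∈ _ → XY x∈) x∈Y x∉X
                               (subst (λ k → 0 < isZero k) (sym qx) (s≤s z≤n)))

    step : ∀ a → (∃[ D ] (D ∈ L × weight q D ≡ 0)) ⊎ (∃[ a′ ] height a < height a′)
    step (T , T∈) with weight q T ≟ 0
    ... | yes qT≡0 = inj₁ (T , T∈ , qT≡0)
    ... | no  qT≢0 = by-role (role S∉)
      where
      S : Subset n
      S = T ∩ zeros q
      qS : weight q S ≡ 0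
      qS = weight≡0⁺ q S (λ x∈ → ∈-separate⁻ (zero? q) (p∩q⊆q T (zeros q) x∈))
      S⊆T : S ⊆ T
      S⊆T = p∩q⊆p T (zeros q)
      pT≤ : ∀ {Y} → S ⊆ Y → weight p T ≤ weight p Y
      pT≤ {Y} SY = weight-mono p T Y (λ x∈ lt → SY (x∈p∩q⁺ (x∈ , ∈-separate⁺ (zero? q) (vanishesʳ disjoint lt))))
      S∉ : S ∉ L
      S∉ S∈ = qT≢0 (n≤0⇒n≡0 (+-cancelˡ-≤ (weight p S) _ _ (begin
        weight p S + weight q T ≡⟨ balanced S∈ T∈ ⟩
        weight p T + weight q S ≤⟨ +-mono-≤ (pT≤ ⊆-refl) (≤-reflexive qS) ⟩
        weight p S + 0          ∎)))
        where open ≤-Reasoning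
      qT≤ : ∀ {Y} → Y ∈ L → S ⊆ Y → weight q T ≤ weight q Y
      qT≤ {Y} Y∈ SY = +-cancelˡ-≤ (weight p T) _ _ (begin
        weight p T + weight q T ≤⟨ +-monoˡ-≤ _ (pT≤ SY) ⟩
        weight p Y + weight q T ≡⟨ balanced Y∈ T∈ ⟩
        weight p T + weight q Y ∎)
        where open ≤-Reasoning
      zT≤ : ∀ {Y} → S ⊆ Y → weight z T ≤ weight z Y
      zT≤ {Y} SY = weight-mono z T Y (λ {x} x∈ lt → SY (x∈p∩q⁺ (x∈ , ∈-separate⁺ (zero? q) (isZero-positive (q x) lt))))
      by-role : Role S → (∃[ D ] (D ∈ L × weight q D ≡ 0)) ⊎ (∃[ a′ ] height (T , T∈) < height a′)
      by-role (bottom {P} {Q} {T′} P∈ Q∈ T′∈ SP SQ PT′ QT′ i) =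
        inj₂ ((T′ , T′∈) , ≤-<-trans (+-mono-≤ (qT≤ P∈ SP) (zT≤ SP)) (height-mono-< PT′))
      by-role (middle {D} D∈ _ _ DS _ _ _ _) =
        inj₁ (D , D∈ , n≤0⇒n≡0 (subst (weight q D ≤_) qS (weight-mono q D S (λ x∈ _ → DS x∈))))
      by-role (top D∈ P∈ Q∈ DP DQ PS QS i) =
        ⊥-elim (incomparable-impossible D∈ P∈ Q∈ T∈ DP (⊆-trans PS S⊆T) DQ (⊆-trans QS S⊆T) i)

  -- Members of weight zero: ground members and `fill`.

  module Even (p q : Fin n → ℕ) (disjoint : SignsDisjoint p q)
              (even : ∀ {X} → X ∈ L → weight p X ≡ weight q X) where

    Ground : Subset n → Set
    Ground D = D ∈ L × weight q D ≡ 0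

    ground-p : ∀ {D} → Ground D → weight p D ≡ 0
    ground-p (D∈ , qD) = trans (even D∈) qD

    -- p-positive and q-free, so never a member: it is the set S that is tested against X.
    fill : Subset n → Subset n
    fill X = (X ∩ zeros q) ∪ supp p

    supp⊆fill : ∀ {X} → supp p ⊆ fill X
    supp⊆fill {X} = q⊆p∪q (X ∩ zeros q) (supp p)

    zeros⊆fill : ∀ {X x} → x ∈ₛ X → q x ≡ 0 → x ∈ₛ fill X
    zeros⊆fill x∈ qx = p⊆p∪q (supp p) (x∈p∩q⁺ (x∈ , ∈-separate⁺ (zero? q) qx))

    fill⁻ : ∀ {X x} → x ∈ₛ fill X → (x ∈ₛ X × q x ≡ 0) ⊎ 0 < p x
    fill⁻ {X} x∈ with x∈p∪q⁻ (X ∩ zeros q) (supp p) x∈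
    ... | inj₁ l = inj₁ (p∩q⊆p X (zeros q) l , ∈-separate⁻ (zero? q) (p∩q⊆q X (zeros q) l))
    ... | inj₂ r = inj₂ (∈-separate⁻ (positive? p) r)

    q-fill : ∀ X → weight q (fill X) ≡ 0
    q-fill X = weight≡0⁺ q (fill X) (λ x∈ → qx (fill⁻ x∈))
      where
      qx : ∀ {x} → (x ∈ₛ X × q x ≡ 0) ⊎ 0 < p x → q x ≡ 0
      qx (inj₁ (_ , e)) = e
      qx (inj₂ lt)      = vanishesʳ disjoint lt

    -- `Z` inherits zero `q`-weight from `fill X`, hence has zero `p`-weight by `even`. It thus
    -- avoids `supp p`, and the rest of `fill X` lies in `X`.
    below-fill : ∀ {X Z} → Z ∈ L → Z ⊆ fill X → Ground Z × Z ⊆ X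
    below-fill {X} {Z} Z∈ Z⊆ = (Z∈ , qZ) , λ x∈ → in-X x∈ (fill⁻ (Z⊆ x∈))
      where
      qZ : weight q Z ≡ 0
      qZ = n≤0⇒n≡0 (subst (weight q Z ≤_) (q-fill X) (weight-mono q Z (fill X) (λ x∈ _ → Z⊆ x∈)))
      in-X : ∀ {x} → x ∈ₛ Z → (x ∈ₛ X × q x ≡ 0) ⊎ 0 < p x → x ∈ₛ X
      in-X x∈ (inj₁ (x∈X , _)) = x∈X
      in-X x∈ (inj₂ lt) = contradiction (weight≡0⁻ p Z (ground-p (Z∈ , qZ)) x∈) (>⇒≢ lt)

    fill∉ : ∀ {y} → 0 < p y → ∀ X → fill X ∉ L
    fill∉ lt X fill∈ = contradiction
      (weight≡0⁻ p (fill X) (trans (even fill∈) (q-fill X)) (supp⊆fill {X} (∈-separate⁺ (positive? p) lt)))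
      (>⇒≢ lt)

    -- Being `q`-free, `D` lies below `fill X`. If `fill X` were a bottom, `D` could replace it; if
    -- it were a top, `X` could, by `below-fill`. Only the middle role is left.
    cover-fill : ∀ {y} → 0 < p y → ∀ {D X} → Ground D → X ∈ L → D ⊆ X → ∃[ T ] (T ∈ L × fill X ⊆ T)
    cover-fill lt {D} {X} (D∈ , qD) X∈ DX = by-role (role (fill∉ lt X))
      where
      D⊆fill : D ⊆ fill X
      D⊆fill x∈ = zeros⊆fill (DX x∈) (weight≡0⁻ q D qD x∈)
      by-role : Role (fill X) → ∃[ T ] (T ∈ L × fill X ⊆ T)
      by-role (bottom P∈ Q∈ T∈ SP SQ PT QT i) = ⊥-elim (incomparable-impossible D∈ P∈ Q∈ T∈
        (⊆-trans D⊆fill SP) (proj₁ PT) (⊆-trans D⊆fill SQ) QT i)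
      by-role (middle {T = T} _ _ T∈ _ ST _ _ _) = T , T∈ , ST
      by-role (top D∈ P∈ Q∈ DP DQ PS QS i) = ⊥-elim (incomparable-impossible D∈ P∈ Q∈ X∈
        DP (proj₂ (below-fill {X} P∈ PS)) DQ (proj₂ (below-fill {X} Q∈ QS)) i)

  -- Contradiction from a positive value of `p`.

  module Imbalanced (p q : Fin n → ℕ) (disjoint : SignsDisjoint p q)
                    (even : ∀ {X} → X ∈ L → weight p X ≡ weight q X)
                    {y : Fin n} (y-positive : 0 < p y)
                    {D₀ : Subset n} (D₀∈ : D₀ ∈ L) (qD₀ : weight q D₀ ≡ 0) where

    open Even p q disjoint even
    private
      -- With signs exchanged, `cover-fill` supplies a member containing `supp q`.
      module Swapped = Even q p (λ x → swap (disjoint x)) (λ X∈ → sym (even X∈))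

    -- A member `T` containing `supp q` has the largest possible `q`-weight. As `Z` contains
    -- `supp p`, its `p`-weight is at least that of `T`, and `even` carries this over to `q`.
    supp-p⇒supp-q : ∀ {Z} → Z ∈ L → supp p ⊆ Z → ∀ {x} → 0 < q x → x ∈ₛ Z
    supp-p⇒supp-q {Z} Z∈ PZ {x} lt with x ∈? Z
    ... | yes x∈ = x∈
    ... | no  x∉ = ⊥-elim (<-irrefl refl (begin-strict
      weight q Z <⟨ weight-mono-< q Z ⊤ (λ _ _ → ∈⊤) ∈⊤ x∉ lt ⟩
      weight q ⊤ ≤⟨ weight-mono q ⊤ T (λ _ l → T⊇ (Swapped.supp⊆fill {D₀} (∈-separate⁺ (positive? q) l))) ⟩
      weight q T ≡⟨ sym (even T∈) ⟩
      weight p T ≤⟨ weight-mono p T Z (λ _ l → PZ (∈-separate⁺ (positive? p) l)) ⟩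
      weight p Z ≡⟨ even Z∈ ⟩
      weight q Z ∎))
      where
      open ≤-Reasoning
      cover : ∃[ T ] (T ∈ L × Swapped.fill D₀ ⊆ T)
      cover = Swapped.cover-fill lt (D₀∈ , trans (even D₀∈) qD₀) D₀∈ ⊆-refl
      T : Subset n
      T = proj₁ cover
      T∈ : T ∈ L
      T∈ = proj₁ (proj₂ cover)
      T⊇ : Swapped.fill D₀ ⊆ T
      T⊇ = proj₂ (proj₂ cover)

    -- `fill X` loses the points of `X` with positive `q`; `supp-p⇒supp-q` restores them in `Z`.
    above-fill : ∀ {X Z} → Z ∈ L → fill X ⊆ Z → X ⊆ Z
    above-fill {X} {Z} Z∈ SZ {x} x∈ with q x ≟ 0
    ... | yes qx = SZ (zeros⊆fill x∈ qx)
    ... | no  qx = supp-p⇒supp-q Z∈ (⊆-trans (supp⊆fill {X}) SZ) (n≢0⇒n>0 qx)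

    Capped : Subset n → Set
    Capped X = ∃[ T ] (T ∈ L × X ⊆ T × supp p ⊆ T)

    grounded⇒capped : ∀ {D X} → Ground D → X ∈ L → D ⊆ X → Capped X
    grounded⇒capped {X = X} gD X∈ DX with cover-fill y-positive gD X∈ DX
    ... | T , T∈ , ST = T , T∈ , above-fill T∈ ST , ⊆-trans (supp⊆fill {X}) ST

    -- If `fill X` were a bottom, `X` could replace it by `above-fill`; if it were a top, the cap
    -- `T` could. In the remaining role the set below it is ground by `below-fill`.
    capped⇒grounded : ∀ {X} → X ∈ L → Capped X → ∃[ D ] (Ground D × D ⊆ X)
    capped⇒grounded {X} X∈ (T , T∈ , XT , PT) = by-role (role (fill∉ y-positive X))
      where
      S⊆T : fill X ⊆ T
      S⊆T x∈ with fill⁻ {X} x∈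
      ... | inj₁ (x∈X , _) = XT x∈X
      ... | inj₂ lt        = PT (∈-separate⁺ (positive? p) lt)
      by-role : Role (fill X) → ∃[ D ] (Ground D × D ⊆ X)
      by-role (bottom P∈ Q∈ T′∈ SP SQ PT′ QT′ i) = ⊥-elim (incomparable-impossible X∈ P∈ Q∈ T′∈
        (above-fill P∈ SP) (proj₁ PT′) (above-fill Q∈ SQ) QT′ i)
      by-role (middle {D} D∈ _ _ DS _ _ _ _) = D , below-fill {X} D∈ DS
      by-role (top D∈ P∈ Q∈ DP DQ PS QS i) = ⊥-elim (incomparable-impossible D∈ P∈ Q∈ T∈
        DP (⊆-trans PS S⊆T) DQ (⊆-trans QS S⊆T) i)

    Avoiding : Subset n → Set
    Avoiding B = B ∈ L × y ∉ₛ B × ∃[ D ] (Ground D × D ⊆ B)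

    extend : (a : Σ _ Avoiding) → ∃[ a′ ] ∣ proj₁ a ∣ < ∣ proj₁ {B = Avoiding} a′ ∣
    extend (B , B∈ , y∉B , D , gD , DB) = by-role (role S∉)
      where
      S : Subset n
      S = ⁅ y ⁆ ∪ B
      y∈S : y ∈ₛ S
      y∈S = p⊆p∪q B (x∈⁅x⁆ y)
      B⊆S : B ⊆ S
      B⊆S = q⊆p∪q ⁅ y ⁆ B
      S⁻ : ∀ {x} → x ∈ₛ S → x ≡ y ⊎ x ∈ₛ B
      S⁻ x∈ with x∈p∪q⁻ ⁅ y ⁆ B x∈
      ... | inj₁ x∈y = inj₁ (x∈⁅y⁆⇒x≡y y x∈y)
      ... | inj₂ x∈B = inj₂ x∈B
      S⊆ : ∀ {Z} → y ∈ₛ Z → B ⊆ Z → S ⊆ Z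
      S⊆ y∈ BZ x∈ with S⁻ x∈
      ... | inj₁ refl = y∈
      ... | inj₂ x∈B  = BZ x∈B
      S∉ : S ∉ L
      S∉ S∈ = <-irrefl refl (begin-strict
        weight p B <⟨ weight-mono-< p B S (λ x∈ _ → B⊆S x∈) y∈S y∉B y-positive ⟩
        weight p S ≡⟨ even S∈ ⟩
        weight q S ≤⟨ weight-mono q S B drop-y ⟩
        weight q B ≡⟨ sym (even B∈) ⟩
        weight p B ∎)
        where
        open ≤-Reasoning
        drop-y : ∀ {x} → x ∈ₛ S → 0 < q x → x ∈ₛ B
        drop-y x∈ lt with S⁻ x∈
        ... | inj₁ refl = contradiction (vanishesʳ disjoint y-positive) (>⇒≢ lt)
        ... | inj₂ x∈B  = x∈B
      capped : Capped B
      capped = grounded⇒capped gD B∈ DB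
      T : Subset n
      T = proj₁ capped
      T∈ : T ∈ L
      T∈ = proj₁ (proj₂ capped)
      P⊆T : supp p ⊆ T
      P⊆T = proj₂ (proj₂ (proj₂ capped))
      S⊆T : S ⊆ T
      S⊆T = S⊆ (P⊆T (∈-separate⁺ (positive? p) y-positive)) (proj₁ (proj₂ (proj₂ capped)))

      by-role : Role S → ∃[ a′ ] ∣ B ∣ < ∣ proj₁ {B = Avoiding} a′ ∣
      by-role (bottom P∈ Q∈ T′∈ SP SQ PT′ QT′ i) = ⊥-elim (incomparable-impossible B∈ P∈ Q∈ T′∈
        (⊆-trans B⊆S SP) (proj₁ PT′) (⊆-trans B⊆S SQ) QT′ i)
      by-role (top D∈ P∈ Q∈ DP DQ PS QS i) = ⊥-elim (incomparable-impossible D∈ P∈ Q∈ T∈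
        DP (⊆-trans PS S⊆T) DQ (⊆-trans QS S⊆T) i)
      -- The cap `T` of `B` also caps `D*`, which yields a ground member below `D*`.
      by-role (middle {D*} {Q} D*∈ Q∈ T*∈ D*S ST* D*Q QT* (S⊈Q , Q⊈S))
        with capped⇒grounded D*∈ (T , T∈ , ⊆-trans D*S S⊆T , P⊆T)
      ... | D₁ , gD₁ , D₁D* with comparable (proj₁ gD₁) B∈ Q∈ T*∈ D₁⊆B (⊆-trans B⊆S ST*) (⊆-trans D₁D* D*Q) QT*
        where
        -- A ground set avoids `y`, so it descends from `S` to `B`.
        D₁⊆B : D₁ ⊆ B
        D₁⊆B x∈ with S⁻ (D*S (D₁D* x∈))
        ... | inj₁ refl = contradiction (weight≡0⁻ p D₁ (ground-p gD₁) x∈) (>⇒≢ y-positive)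
        ... | inj₂ x∈B  = x∈B
      ... | inj₂ QB = ⊥-elim (Q⊈S (⊆-trans QB B⊆S))
      ... | inj₁ BQ = (Q , Q∈ , (λ y∈Q → S⊈Q (S⊆ y∈Q BQ)) , D₁ , gD₁ , λ x∈ → D*Q (D₁D* x∈)) ,
                      p⊂q⇒∣p∣<∣q∣ (⊆∧⊈⇒⊂ BQ (λ QB → Q⊈S (⊆-trans QB B⊆S)))

    impossible : Data.Empty.⊥
    -- Every step ascends and the target type is empty, so bounded cardinality is itself the
    -- contradiction.
    impossible = ascend {A = Σ _ Avoiding} (λ (B , _) → ∣ B ∣) n (λ (B , _) → ∣p∣≤n B)
      (λ a → inj₂ (extend a)) (D₀ , D₀∈ , y∉D₀ , D₀ , (D₀∈ , qD₀) , ⊆-refl)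
      where
      y∉D₀ : y ∉ₛ D₀
      y∉D₀ y∈ = contradiction (weight≡0⁻ p D₀ (ground-p (D₀∈ , qD₀)) y∈) (>⇒≢ y-positive)

  -- Rigidity: only the zero vector is constant on the family.

  -- Comparing a `q`-free `D` with a `p`-free `E` shows that the constant value of p - q is 0.
  -- `Imbalanced` then excludes positive values of `p` and, with signs exchanged, of `q`.
  rigid : ∀ {X} → X ∈ L → (p q : Fin n → ℕ) → SignsDisjoint p q →
          (∀ {X Y} → X ∈ L → Y ∈ L → weight p X + weight q Y ≡ weight p Y + weight q X) →
          ∀ x → p x ≡ 0 × q x ≡ 0
  rigid X∈ p q disjoint balanced x
    with weight-free-member p q disjoint balanced X∈
       | weight-free-member q p (λ x → swap (disjoint x))
           (λ {X} {Y} X∈ Y∈ → trans (+-comm (weight q X) (weight p Y))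
             (trans (balanced Y∈ X∈) (+-comm (weight p X) (weight q Y)))) X∈
  ... | D , D∈ , qD | E , E∈ , pE = px , qx
    where
    pD : weight p D ≡ 0
    pD = m+n≡0⇒m≡0 (weight p D) (trans (balanced D∈ E∈) (cong₂ _+_ pE qD))
    even : ∀ {X} → X ∈ L → weight p X ≡ weight q X
    even {X} X∈ = begin
      weight p X              ≡⟨ sym (+-identityʳ _) ⟩
      weight p X + 0          ≡⟨ cong (λ k → weight p X + k) (sym qD) ⟩
      weight p X + weight q D ≡⟨ balanced X∈ D∈ ⟩
      weight p D + weight q X ≡⟨ cong (λ k → k + weight q X) pD ⟩
      weight q X              ∎
      where open ≡-Reasoning
    px : p x ≡ 0
    px = n≤0⇒n≡0 (≮⇒≥ λ lt → Imbalanced.impossible p q disjoint even lt D∈ qD)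
    qx : q x ≡ 0
    qx = n≤0⇒n≡0 (≮⇒≥ λ lt → Imbalanced.impossible q p (λ x → swap (disjoint x)) (λ X∈ → sym (even X∈)) lt D∈ pD)

  -- If `L` were empty, adding `⊥` would create a diamond whose other sets lie in `L`.
  inhabited : ∃[ X ] X ∈ L
  inhabited = pick L refl
    where
    participant : Role ⊥ → ∃[ X ] X ∈ L
    participant (bottom P∈ _ _ _ _ _ _ _) = _ , P∈
    participant (middle D∈ _ _ _ _ _ _ _) = _ , D∈
    participant (top D∈ _ _ _ _ _ _ _)    = _ , D∈
    pick : ∀ xs → xs ≡ L → ∃[ X ] X ∈ L
    pick (X ∷ _) refl = X , here refl
    pick []      eq   = participant (role (subst (⊥ ∉_) eq λ ()))

-- Integer linear algebra.

dot : ∀ {n} → Vec ℤ n → Vec ℤ n → ℤ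
dot []       []       = 0ℤ
dot (a ∷ as) (b ∷ bs) = a ℤ.* b ℤ.+ dot as bs

dot-zeroʳ : ∀ {n} (v : Vec ℤ n) → dot v (replicate n 0ℤ) ≡ 0ℤ
dot-zeroʳ []       = refl
dot-zeroʳ (a ∷ as) = cong₂ ℤ._+_ (ℤ.*-zeroʳ a) (dot-zeroʳ as)

dot-scaleʳ : ∀ {n} k (u v : Vec ℤ n) → dot u (Vec.map (k ℤ.*_) v) ≡ k ℤ.* dot u v
dot-scaleʳ k []       []       = sym (ℤ.*-zeroʳ k)
dot-scaleʳ k (a ∷ as) (b ∷ bs) =
  trans (cong (λ d → a ℤ.* (k ℤ.* b) ℤ.+ d) (dot-scaleʳ k as bs)) (lemma a k b (dot as bs))
  where
  lemma : ∀ a k b d → a ℤ.* (k ℤ.* b) ℤ.+ k ℤ.* d ≡ k ℤ.* (a ℤ.* b ℤ.+ d)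
  lemma = solve-∀

-- Cross-multiplication clears the first column without division; the vanishing head is dropped.
eliminate : ∀ {n} → Vec ℤ (suc n) → Vec ℤ (suc n) → Vec ℤ n
eliminate (a ∷ r) (b ∷ s) = zipWith (λ s′ r′ → a ℤ.* s′ ℤ.- b ℤ.* r′) s r

dot-combination : ∀ {n} a b (s r v : Vec ℤ n) →
  dot (zipWith (λ s′ r′ → a ℤ.* s′ ℤ.- b ℤ.* r′) s r) v ≡ a ℤ.* dot s v ℤ.- b ℤ.* dot r v
dot-combination a b [] [] [] = sym (lemma a b)
  where
  lemma : ∀ a b → a ℤ.* 0ℤ ℤ.- b ℤ.* 0ℤ ≡ 0ℤ
  lemma = solve-∀
dot-combination a b (s ∷ ss) (r ∷ rs) (v ∷ vs) =
  trans (cong (λ d → (a ℤ.* s ℤ.- b ℤ.* r) ℤ.* v ℤ.+ d) (dot-combination a b ss rs vs)) (lemma a b s r v (dot ss vs) (dot rs vs))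
  where
  lemma : ∀ a b s r v d e → (a ℤ.* s ℤ.- b ℤ.* r) ℤ.* v ℤ.+ (a ℤ.* d ℤ.- b ℤ.* e)
          ≡ a ℤ.* (s ℤ.* v ℤ.+ d) ℤ.- b ℤ.* (r ℤ.* v ℤ.+ e)
  lemma = solve-∀

-- Fraction-free Gaussian elimination.
kernel : ∀ n (rows : List (Vec ℤ n)) → length rows < n →
         ∃[ x ] ((∃[ i ] lookup x i ≢ 0ℤ) × (∀ {r} → r ∈ rows → dot r x ≡ 0ℤ))
kernel (suc n) rows rows<n with any? (λ r → ¬? (head r ℤ.≟ 0ℤ)) rows
-- All heads vanish, so the first unit vector is a solution.
... | no heads≡0 = 1ℤ ∷ replicate n 0ℤ , (zero , λ ()) , λ {r} r∈ → solves r (decidable-stable (head r ℤ.≟ 0ℤ) λ h≢0 → heads≡0 (lose r∈ h≢0))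
  where
  solves : ∀ r → head r ≡ 0ℤ → dot r (1ℤ ∷ replicate n 0ℤ) ≡ 0ℤ
  solves (_ ∷ r) refl = trans (ℤ.+-identityˡ _) (dot-zeroʳ r)
... | yes pivot with find pivot
...   | a ∷ r , r∈ , a≢0 with ∈-∃++ r∈
...     | ys , zs , refl with kernel n (map (eliminate (a ∷ r)) (ys ++ zs)) smaller
  where
  smaller : length (map (eliminate (a ∷ r)) (ys ++ zs)) < n
  smaller = ≤-pred (subst (_< suc n) (begin
    length (ys ++ (a ∷ r) ∷ zs)                   ≡⟨ length-++ ys ⟩
    length ys + suc (length zs)                   ≡⟨ +-suc (length ys) (length zs) ⟩
    suc (length ys + length zs)                   ≡⟨ cong suc (sym (length-++ ys)) ⟩
    suc (length (ys ++ zs))                       ≡⟨ cong suc (sym (length-map _ (ys ++ zs))) ⟩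
    suc (length (map (eliminate (a ∷ r)) (ys ++ zs))) ∎) rows<n)
    where open ≡-Reasoning
...       | x , (i , xᵢ≢0) , solves = x′ , (suc i , x′ᵢ≢0) , solves′
  where
  x′ : Vec ℤ (suc n)
  -- Back substitution scaled by the pivot `a`, which keeps the solution integral.
  x′ = ℤ.- dot r x ∷ Vec.map (a ℤ.*_) x
  x′ᵢ≢0 : lookup (Vec.map (a ℤ.*_) x) i ≢ 0ℤ
  x′ᵢ≢0 eq with ℤ.i*j≡0⇒i≡0∨j≡0 a (trans (sym (lookup-map i (a ℤ.*_) x)) eq)
  ... | inj₁ a≡0  = a≢0 a≡0
  ... | inj₂ xᵢ≡0 = xᵢ≢0 xᵢ≡0
  dot-x′ : ∀ b s → dot (b ∷ s) x′ ≡ a ℤ.* dot s x ℤ.- b ℤ.* dot r x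
  dot-x′ b s = trans (cong (λ d → b ℤ.* (ℤ.- dot r x) ℤ.+ d) (dot-scaleʳ a s x)) (lemma a b (dot r x) (dot s x))
    where
    lemma : ∀ a b d e → b ℤ.* (ℤ.- d) ℤ.+ a ℤ.* e ≡ a ℤ.* e ℤ.- b ℤ.* d
    lemma = solve-∀
  rest : ∀ {s} → s ∈ ys ++ zs → dot s x′ ≡ 0ℤ
  rest {b ∷ s} s∈ = trans (dot-x′ b s) (trans (sym (dot-combination a b s r x)) (solves (∈-map⁺ (eliminate (a ∷ r)) s∈)))
  solves′ : ∀ {s} → s ∈ ys ++ (a ∷ r) ∷ zs → dot s x′ ≡ 0ℤ
  solves′ s∈ with ∈-++⁻ ys s∈
  ... | inj₁ s∈ys         = rest (∈-++⁺ˡ s∈ys)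
  ... | inj₂ (here refl)  = trans (dot-x′ a r) (ℤ.+-inverseʳ (a ℤ.* dot r x))
  ... | inj₂ (there s∈zs) = rest (∈-++⁺ʳ ys s∈zs)

-- The lower bound.

pos neg : ℤ → ℕ
pos (+ k)    = k
pos -[1+ k ] = 0
neg (+ k)    = 0
neg -[1+ k ] = suc k

pos-neg : ∀ a → a ≡ + pos a ℤ.- + neg a
pos-neg (+ k)    = sym (ℤ.+-identityʳ (+ k))
pos-neg -[1+ k ] = refl

indicator : ∀ {n} → Subset n → Vec ℤ n
indicator = Vec.map (λ b → if b then 1ℤ else 0ℤ)

dot-indicator : ∀ {n} (X : Subset n) (w : Vec ℤ n) →
  dot (indicator X) w ≡ + weight (λ x → pos (lookup w x)) X ℤ.- + weight (λ x → neg (lookup w x)) X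
dot-indicator [] [] = refl
dot-indicator (false ∷ X) (a ∷ w) =
  trans (ℤ.+-identityˡ (dot (indicator X) w)) (dot-indicator X w)
dot-indicator (true ∷ X) (a ∷ w) = trans
  (cong₂ ℤ._+_ (trans (ℤ.*-identityˡ a) (pos-neg a)) (dot-indicator X w))
  (lemma (+ pos a) (+ neg a) (+ weight (λ x → pos (lookup w x)) X) (+ weight (λ x → neg (lookup w x)) X))
  where
  lemma : ∀ a b c d → (a ℤ.- b) ℤ.+ (c ℤ.- d) ≡ (a ℤ.+ c) ℤ.- (b ℤ.+ d)
  lemma = solve-∀

-- At most `n` rows in `n + 1` unknowns have a nonzero kernel vector. Its first entry `c` is minus
-- the common weight of the members under the remaining entries `w`, so `rigid` applies to `w`.
lower-bound : ∀ {n} (F : Family n) → DiamondSaturated F → n < size F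
lower-bound {n} F (free , saturated) = ≰⇒> λ size≤n →
  let x , nonzero , solves = kernel (suc n) (map (λ X → 1ℤ ∷ indicator X) (sets F))
        (s≤s (subst (_≤ n) (sym (length-map _ (sets F))) size≤n))
  in affinely-independent x nonzero (λ X∈ → solves (∈-map⁺ (λ X → 1ℤ ∷ indicator X) X∈))
  where
  open Saturated (sets F) free saturated
  affinely-independent : ∀ x → (∃[ i ] lookup x i ≢ 0ℤ) → ¬ (∀ {X} → X ∈ sets F → dot (1ℤ ∷ indicator X) x ≡ 0ℤ)
  affinely-independent (c ∷ w) (i , xᵢ≢0) solves = xᵢ≢0 (vanishes i)
    where
    p q : Fin n → ℕ
    p x = pos (lookup w x)
    q x = neg (lookup w x)
    disjoint : SignsDisjoint p q
    disjoint x with lookup w x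
    ... | + _      = inj₂ refl
    ... | -[1+ _ ] = inj₁ refl
    value : ∀ {X} → X ∈ sets F → c ℤ.+ (+ weight p X ℤ.- + weight q X) ≡ 0ℤ
    value {X} X∈ = trans (cong₂ ℤ._+_ (sym (ℤ.*-identityˡ c)) (sym (dot-indicator X w))) (solves X∈)
    balanced : ∀ {X Y} → X ∈ sets F → Y ∈ sets F → weight p X + weight q Y ≡ weight p Y + weight q X
    balanced {X} {Y} X∈ Y∈ = ℤ.+-injective (ℤ.i-j≡0⇒i≡j _ _ (begin
      (+ weight p X ℤ.+ + weight q Y) ℤ.- (+ weight p Y ℤ.+ + weight q X)
        ≡⟨ lemma c (+ weight p X) (+ weight q X) (+ weight p Y) (+ weight q Y) ⟩
      (c ℤ.+ (+ weight p X ℤ.- + weight q X)) ℤ.- (c ℤ.+ (+ weight p Y ℤ.- + weight q Y))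
        ≡⟨ cong₂ ℤ._-_ (value X∈) (value Y∈) ⟩
      0ℤ ∎))
      where
      open ≡-Reasoning
      lemma : ∀ c a b a′ b′ → (a ℤ.+ b′) ℤ.- (a′ ℤ.+ b) ≡ (c ℤ.+ (a ℤ.- b)) ℤ.- (c ℤ.+ (a′ ℤ.- b′))
      lemma = solve-∀
    parts≡0 : ∀ x → p x ≡ 0 × q x ≡ 0
    parts≡0 = rigid (proj₂ inhabited) p q disjoint balanced
    vanishes : ∀ i → lookup (c ∷ w) i ≡ 0ℤ
    -- Once `w` vanishes, the equation of a single member forces `c` to be 0; hence the need for
    -- `inhabited`.
    vanishes zero = begin
      c                                            ≡⟨ sym (ℤ.+-identityʳ c) ⟩
      c ℤ.+ (+ 0 ℤ.- + 0)                          ≡⟨ cong₂ (λ a b → c ℤ.+ (+ a ℤ.- + b))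
                                                        (sym (weight≡0⁺ p X (λ {x} _ → proj₁ (parts≡0 x))))
                                                        (sym (weight≡0⁺ q X (λ {x} _ → proj₂ (parts≡0 x)))) ⟩
      c ℤ.+ (+ weight p X ℤ.- + weight q X)        ≡⟨ value (proj₂ inhabited) ⟩
      0ℤ                                           ∎
      where
      open ≡-Reasoning
      X : Subset n
      X = proj₁ inhabited
    vanishes (suc x) = trans (pos-neg (lookup w x))
      (cong₂ (λ a b → + a ℤ.- + b) (proj₁ (parts≡0 x)) (proj₂ (parts≡0 x)))

-- The full chain attains the bound.

initialSegments : ∀ n → List (Subset n)
initialSegments zero    = [] ∷ []
initialSegments (suc n) = ⊥ ∷ map (inside ∷_) (initialSegments n)

length-initialSegments : ∀ n → length (initialSegments n) ≡ suc n
length-initialSegments zero    = refl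
length-initialSegments (suc n) =
  cong suc (trans (length-map (inside ∷_) (initialSegments n)) (length-initialSegments n))

unique-initialSegments : ∀ n → Unique (initialSegments n)
unique-initialSegments zero    = All.[] ∷ []
unique-initialSegments (suc n) =
  All.map⁺ (All.universal (λ _ ()) (initialSegments n)) ∷ Unique.map⁺ ∷-injectiveʳ (unique-initialSegments n)

⊥∈initialSegments : ∀ n → ⊥ ∈ initialSegments n
⊥∈initialSegments zero    = here refl
⊥∈initialSegments (suc n) = here refl

⊤∈initialSegments : ∀ n → ⊤ ∈ initialSegments n
⊤∈initialSegments zero    = here refl
⊤∈initialSegments (suc n) = there (∈-map⁺ (inside ∷_) (⊤∈initialSegments n))

initialSegments-chain : ∀ n {P Q} → P ∈ initialSegments n → Q ∈ initialSegments n → P ⊆ Q ⊎ Q ⊆ P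
initialSegments-chain zero    (here refl) (here refl) = inj₁ ⊆-refl
initialSegments-chain (suc n) (here refl) _           = inj₁ (⊆-min _)
initialSegments-chain (suc n) (there _)   (here refl) = inj₂ (⊆-min _)
initialSegments-chain (suc n) (there P∈)  (there Q∈) with ∈-map⁻ (inside ∷_) P∈ | ∈-map⁻ (inside ∷_) Q∈
... | P , P∈′ , refl | Q , Q∈′ , refl with initialSegments-chain n P∈′ Q∈′
...   | inj₁ PQ = inj₁ (s⊆s PQ)
...   | inj₂ QP = inj₂ (s⊆s QP)

-- If `S` contains the first point, recursion on the tail applies. Otherwise the singleton of that
-- point serves, since `S` is nonempty: `⊥` belongs to the chain.
incomparable-initialSegment : ∀ n {S} → S ∉ initialSegments n → ∃[ Q ] (Q ∈ initialSegments n × Incomparable S Q)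
incomparable-initialSegment zero {[]} S∉ = contradiction (here refl) S∉
incomparable-initialSegment (suc n) {true ∷ S} S∉
  with incomparable-initialSegment n {S} (λ S∈ → S∉ (there (∈-map⁺ (inside ∷_) S∈)))
... | Q , Q∈ , S⊈Q , Q⊈S =
  inside ∷ Q , there (∈-map⁺ (inside ∷_) Q∈) , (λ le → S⊈Q (drop-∷-⊆ le)) , (λ le → Q⊈S (drop-∷-⊆ le))
incomparable-initialSegment (suc n) {false ∷ S} S∉ =
  inside ∷ ⊥ , there (∈-map⁺ (inside ∷_) (⊥∈initialSegments n)) ,
  (λ le → S∉ (here (cong (outside ∷_) (⊆-antisym (drop-∷-⊆ le) (⊆-min S))))) ,
  (λ le → contradiction (le here) λ ())

fullChain : ∀ n → Family n
fullChain n = family (initialSegments n) (unique-initialSegments n)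

fullChain-saturated : ∀ n → DiamondSaturated (fullChain n)
fullChain-saturated n = free , saturated
  where
  free : ¬ InducedDiamondIn (initialSegments n)
  free (_ , _ , _ , _ , _ , P∈ , Q∈ , _ , _ , _ , _ , _ , P⊈Q , Q⊈P) with initialSegments-chain n P∈ Q∈
  ... | inj₁ PQ = P⊈Q PQ
  ... | inj₂ QP = Q⊈P QP
  saturated : ∀ S → S ∉ initialSegments n → InducedDiamondIn (S ∷ initialSegments n)
  saturated S S∉ with incomparable-initialSegment n S∉
  -- `⊥` and `⊤` close the diamond around any incomparable pair, whose incomparability gives all the
  -- strictness.
  ... | Q , Q∈ , S⊈Q , Q⊈S =
    ⊥ , S , Q , ⊤ , there (⊥∈initialSegments n) , here refl , there Q∈ , there (⊤∈initialSegments n) ,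
    ⊆∧⊈⇒⊂ (⊆-min S) (λ S⊆⊥ → S⊈Q (⊆-trans S⊆⊥ (⊆-min Q))) ,
    ⊆∧⊈⇒⊂ (⊆-max S) (λ ⊤⊆S → Q⊈S (⊆-trans (⊆-max Q) ⊤⊆S)) ,
    ⊆∧⊈⇒⊂ (⊆-min Q) (λ Q⊆⊥ → Q⊈S (⊆-trans Q⊆⊥ (⊆-min S))) ,
    ⊆∧⊈⇒⊂ (⊆-max Q) (λ ⊤⊆Q → S⊈Q (⊆-trans (⊆-max S) ⊤⊆Q)) ,
    S⊈Q , Q⊈S

theorem1p2 : ∀ (n : ℕ) → n ≥ 1 →
    (∀ (F : Family n) → DiamondSaturated F → size F ≥ n + 1) ×
    (∃[ F ] (DiamondSaturated {n} F × size F ≡ n + 1))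
theorem1p2 n _ =
  (λ F saturated → subst (_≤ size F) (sym (+-comm n 1)) (lower-bound F saturated)) ,
  fullChain n , fullChain-saturated n , trans (length-initialSegments n) (sym (+-comm n 1))
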